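{- Let $n$, $k$ and $\ell$ be integers with $k\geq \ell\geq 1$ and $n\geq \ell+2$. Let $G$ be an $n$-vertex graph and let $v_1,\ldots,v_n$ be a labelling of $V(G)$ such that every edge $v_iv_j\in E(G)$ satisfies $|i-j|\leq k$. Suppose that, for each $i\in[n]$, \[ \deg_G(v_i)\geq \min\{\ell+i-1,\ k+\ell,\ k+n-i\}. \] Then $G$ contains a spanning subdivision of $K_{2,\ell}$ rooted at $v_1$ and $v_n$, i.e.\ there exist $\ell$ paths in $G$, each from $v_1$ to $v_n$ and each with at least two edges, which pairwise share no vertices other than $v_1$ and $v_n$, and whose union covers all vertices of $G$.
   Context: A subdivision of a graph $H$ is obtained by replacing each edge of $H$ by a path of positive length, these paths being internally disjoint. A subdivision of $K_{2,\ell}$ rooted at $u,v$ is one in which the two vertices forming the part of size $2$ of $K_{2,\ell}$ are $u$ and $v$. -}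

module Defs where

open import Data.Nat using (ℕ; _+_; _∸_; _≤_; _⊔_; _⊓_; ∣_-_∣; suc)
open import Data.Bool using (Bool; true; false; T)
open import Data.Fin using (Fin; toℕ)
open import Data.List using (List; []; _∷_; _++_; [_]; length; filterᵇ; allFin)
open import Data.List.Relation.Unary.Linked using (Linked)
open import Data.List.Relation.Unary.Unique.Propositional using (Unique)
open import Data.List.Membership.Propositional using (_∈_)
open import Data.Sum using (_⊎_)
open import Data.Product using (Σ; ∃; _×_; _,_)
open import Relation.Binary.PropositionalEquality using (_≡_; _≢_)
open import Relation.Nullary using (¬_)

-- A finite simple graph on vertex set Fin n; vertex a is v_{toℕ a + 1}.
record Graph (n : ℕ) : Set where
  field
    adj    : Fin n → Fin n → Bool
    sym    : ∀ a b → adj a b ≡ adj b a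
    irrefl : ∀ a → adj a a ≡ false
open Graph public

Adj : ∀ {n} → Graph n → Fin n → Fin n → Set
Adj G a b = T (adj G a b)

deg : ∀ {n} → Graph n → Fin n → ℕ
deg {n} G a = length (filterᵇ (adj G a) (allFin n))

Bandwidth≤ : ∀ {n} → Graph n → ℕ → Set
Bandwidth≤ G k = ∀ a b → Adj G a b → ∣ toℕ a - toℕ b ∣ ≤ k

IsV1VnPath : ∀ {n} → Graph n → List (Fin n) → Set
IsV1VnPath {n} G vs =
  Unique vs × Linked (Adj G) vs ×
  Σ (Fin n) λ s → Σ (Fin n) λ t → Σ (List (Fin n)) λ int →
    (vs ≡ s ∷ (int ++ [ t ])) × toℕ s ≡ 0 × toℕ t ≡ n ∸ 1 × int ≢ []

SpanningK2Subdiv : ∀ {n} → Graph n → (ℓ : ℕ) → Set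
SpanningK2Subdiv {n} G ℓ =
  Σ (Fin ℓ → List (Fin n)) λ P →
    (∀ p → IsV1VnPath G (P p)) ×
    (∀ p q → p ≢ q → ∀ v → v ∈ P p → v ∈ P q → toℕ v ≡ 0 ⊎ toℕ v ≡ n ∸ 1) ×
    (∀ v → ∃ λ p → v ∈ P p)

{-# OPTIONS --safe #-}
module Submission where

-- Grow ℓ disjoint paths from v₁, avoiding z = v_n, by a greedy rule: the leftmost current end e
-- moves to its leftmost unvisited neighbour, or stops before z if it has none.  Let E be the
-- current ends, R the unvisited vertices, ρ i the number of neighbours of i in E ∪ R to its right
-- (z counted ℓ times), and μ i the number of non-neighbours of i in E ∪ R at most k to its left.
-- The degree condition gives ρ i ≥ μ i + ℓ at the start.  This bound survives every move, with an
-- extra 1 for each vertex i ∈ R to the left of all ends: such an i was skipped by an end at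
-- most k to its left, and that end no longer counts in μ i.  Hence no end gets stuck before z, and once
-- all ends have stopped nothing is unvisited, since the last vertex i of R would have ρ i ≤ ℓ.

open import Defs
open import Data.Nat using (ℕ; _+_; _∸_; _≤_; _⊓_; suc)
open import Data.Fin using (toℕ)
open import Data.Bool using (T; true; false; if_then_else_)
open import Data.Bool.Properties using (T?)
open import Data.Empty using (⊥-elim)
open import Data.Fin using (Fin; zero; suc; fromℕ; fromℕ<)
open import Data.Fin.Properties using (toℕ-injective; toℕ-fromℕ; toℕ-fromℕ<; toℕ<n; injective⇒≤)
open import Data.List using (List; []; _∷_; [_]; _++_; map; concatMap; length; lookup; filter; allFin)
open import Data.List.Membership.Propositional using (_∈_)
open import Data.List.Membership.Propositional.Properties
open import Data.List.Properties
  using (filter-accept; filter-reject; filter-none; filter-++;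
         length-++; length-filter; length-map; length-tabulate)
open import Data.List.Relation.Binary.Permutation.Propositional
open import Data.List.Relation.Binary.Permutation.Propositional.Properties
  using (∈-resp-↭; All-resp-↭; ↭-length; filter-↭; shift; shifts; ++⁺; ++⁺ˡ; ++⁺ʳ; ↭-map-inv)
import Data.List.Relation.Binary.Permutation.Setoid.Properties as Permutationₛ
open import Data.List.Relation.Unary.All as All using (All; []; _∷_)
import Data.List.Relation.Unary.All.Properties as All
import Data.List.Relation.Unary.Any as Any
open import Data.List.Relation.Unary.Any using (here; there)
open import Data.List.Relation.Unary.Any.Properties using (lookup-index)
open import Data.List.Relation.Unary.AllPairs using ([]; _∷_)
open import Data.List.Relation.Unary.Linked using (Linked; [-]; _∷_)
open import Data.List.Relation.Unary.Unique.Propositional using (Unique)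
import Data.List.Relation.Unary.Unique.Propositional.Properties as Unique
open import Data.Nat using (_<_; z≤n; s≤s; z<s; _<?_; _≤?_)
open import Data.Nat.Properties
open import Data.Product using (_×_; _,_; proj₁; proj₂; ∃; ∃₂)
open import Data.Sum using (_⊎_; inj₁; inj₂; [_,_]′)
open import Data.Unit using (⊤; tt)
open import Function using (_∘_; case_of_)
open import Level using (0ℓ)
open import Relation.Binary.Definitions using (tri<; tri≈; tri>)
open import Relation.Binary.PropositionalEquality
  using (_≡_; _≢_; refl; cong; cong₂; subst; subst₂; setoid) renaming (sym to ≡-sym; trans to ≡-trans)
open import Relation.Nullary using (¬_; Dec; yes; no; ¬?; contradiction)
open import Relation.Nullary.Decidable using (_×-dec_)
open import Relation.Unary using (Pred; Decidable)

-- Minima, lists up to permutation, and concatenations without repetition.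

m⊓n≤o⇒m≤o⊎n≤o : ∀ m n {o} → m ⊓ n ≤ o → m ≤ o ⊎ n ≤ o
m⊓n≤o⇒m≤o⊎n≤o m n m⊓n≤o with ⊓-sel m n
... | inj₁ eq = inj₁ (subst (_≤ _) eq m⊓n≤o)
... | inj₂ eq = inj₂ (subst (_≤ _) eq m⊓n≤o)

module _ {A : Set} where

  Unique-resp-↭ : {xs ys : List A} → xs ↭ ys → Unique xs → Unique ys
  Unique-resp-↭ σ = Permutationₛ.Unique-resp-↭ (setoid A) (↭⇒↭ₛ σ)

  ∈⇒↭∷ : ∀ {x : A} {xs} → x ∈ xs → ∃ λ ys → xs ↭ x ∷ ys
  ∈⇒↭∷ x∈xs with ys , zs , refl ← ∈-∃++ x∈xs = ys ++ zs , shift _ ys zs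

  ++-unique⁻ : ∀ xs {ys : List A} → Unique (xs ++ ys) →
    Unique xs × Unique ys × (∀ {v} → v ∈ xs → ¬ v ∈ ys)
  ++-unique⁻ [] u = [] , u , λ ()
  ++-unique⁻ (x ∷ xs) (x∉ ∷ u) with ux , uy , dis ← ++-unique⁻ xs u =
    All.++⁻ˡ xs x∉ ∷ ux , uy ,
    λ { (here refl) v∈ys → All.lookup (All.++⁻ʳ xs x∉) v∈ys refl
      ; (there v∈xs) v∈ys → dis v∈xs v∈ys }

  lookup-unique-injective : {xs : List A} → Unique xs →
    ∀ i j → lookup xs i ≡ lookup xs j → i ≡ j
  lookup-unique-injective (_ ∷ _) zero zero _ = refl
  lookup-unique-injective (x∉ ∷ _) zero (suc j) eq = ⊥-elim (All.lookup x∉ (∈-lookup j) eq)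
  lookup-unique-injective (x∉ ∷ _) (suc i) zero eq = ⊥-elim (All.lookup x∉ (∈-lookup i) (≡-sym eq))
  lookup-unique-injective (_ ∷ u) (suc i) (suc j) eq = cong suc (lookup-unique-injective u i j eq)

  -- One selection principle serves for the leftmost end, for its leftmost unvisited neighbour and,
  -- with a decreasing `f`, for the last unvisited vertex.
  least : {P : Pred A 0ℓ} (P? : Decidable P) (f : A → ℕ) (xs : List A) →
    All (¬_ ∘ P) xs ⊎
    ∃₂ λ w ys → xs ↭ w ∷ ys × P w × All (λ y → P y → f w ≤ f y) ys
  least P? f [] = inj₁ []
  least P? f (x ∷ xs) with P? x | least P? f xs
  ... | no ¬px | inj₁ none = inj₁ (¬px ∷ none)
  ... | no ¬px | inj₂ (w , ys , σ , pw , min) =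
    inj₂ (w , x ∷ ys , trans (prep x σ) (swap x w refl) , pw , (λ px → contradiction px ¬px) ∷ min)
  ... | yes px | inj₁ none = inj₂ (x , xs , refl , px , All.map (λ ¬p p → contradiction p ¬p) none)
  ... | yes px | inj₂ (w , ys , σ , pw , min) with ≤-total (f x) (f w)
  ...   | inj₁ fx≤fw = inj₂ (x , xs , refl , px ,
            All-resp-↭ (↭-sym σ) ((λ _ → fx≤fw) ∷ All.map (λ h p → ≤-trans fx≤fw (h p)) min))
  ...   | inj₂ fw≤fx =
            inj₂ (w , x ∷ ys , trans (prep x σ) (swap x w refl) , pw , (λ _ → fw≤fx) ∷ min)

module _ {A B : Set} (f : B → List A) where

  concatMap-unique⁻ : ∀ qs → Unique (concatMap f qs) → ∀ i → Unique (f (lookup qs i))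
  concatMap-unique⁻ (q ∷ qs) u zero = proj₁ (++-unique⁻ (f q) u)
  concatMap-unique⁻ (q ∷ qs) u (suc i) = concatMap-unique⁻ qs (proj₁ (proj₂ (++-unique⁻ (f q) u))) i

  ∈-lookup-concatMap : ∀ qs i {v} → v ∈ f (lookup qs i) → v ∈ concatMap f qs
  ∈-lookup-concatMap (q ∷ qs) zero v∈ = ∈-++⁺ˡ v∈
  ∈-lookup-concatMap (q ∷ qs) (suc i) v∈ = ∈-++⁺ʳ (f q) (∈-lookup-concatMap qs i v∈)

  concatMap-disjoint : ∀ qs → Unique (concatMap f qs) → ∀ i j → i ≢ j →
    ∀ {v} → v ∈ f (lookup qs i) → ¬ v ∈ f (lookup qs j)
  concatMap-disjoint (q ∷ qs) u zero zero i≢j _ _ = i≢j refl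
  concatMap-disjoint (q ∷ qs) u zero (suc j) _ v∈ v∈′ =
    proj₂ (proj₂ (++-unique⁻ (f q) u)) v∈ (∈-lookup-concatMap qs j v∈′)
  concatMap-disjoint (q ∷ qs) u (suc i) zero _ v∈ v∈′ =
    proj₂ (proj₂ (++-unique⁻ (f q) u)) v∈′ (∈-lookup-concatMap qs i v∈)
  concatMap-disjoint (q ∷ qs) u (suc i) (suc j) i≢j =
    concatMap-disjoint qs (proj₁ (proj₂ (++-unique⁻ (f q) u))) i j (i≢j ∘ cong suc)

  concatMap-↭ : ∀ {ps qs} → ps ↭ qs → concatMap f ps ↭ concatMap f qs
  concatMap-↭ refl = refl
  concatMap-↭ (prep x σ) = ++⁺ˡ (f x) (concatMap-↭ σ)
  concatMap-↭ (swap x y σ) =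
    trans (shifts (f x) (f y)) (++⁺ˡ (f y) (++⁺ˡ (f x) (concatMap-↭ σ)))
  concatMap-↭ (trans σ τ) = trans (concatMap-↭ σ) (concatMap-↭ τ)

-- Counting list entries.

module _ {A : Set} where

  count : {P : Pred A 0ℓ} → Decidable P → List A → ℕ
  count P? xs = length (filter P? xs)

  module _ {P : Pred A 0ℓ} (P? : Decidable P) where

    count-↭ : ∀ {xs ys} → xs ↭ ys → count P? xs ≡ count P? ys
    count-↭ σ = ↭-length (filter-↭ P? σ)

    count-yes : ∀ {x} xs → P x → count P? (x ∷ xs) ≡ suc (count P? xs)
    count-yes xs px = cong length (filter-accept P? px)

    count-no : ∀ {x} xs → ¬ P x → count P? (x ∷ xs) ≡ count P? xs
    count-no xs ¬px = cong length (filter-reject P? ¬px)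

    count-none : ∀ {xs} → All (¬_ ∘ P) xs → count P? xs ≡ 0
    count-none none = cong length (filter-none P? none)

    count-≤-∷ : ∀ x xs → count P? xs ≤ count P? (x ∷ xs)
    count-≤-∷ x xs with P? x
    ... | yes _ = n≤1+n _
    ... | no _ = ≤-refl

    count-∷-≤ : ∀ x xs → count P? (x ∷ xs) ≤ suc (count P? xs)
    count-∷-≤ x xs with P? x
    ... | yes _ = ≤-refl
    ... | no _ = n≤1+n _

    count-∈ : ∀ {x xs} → x ∈ xs → P x → 1 ≤ count P? xs
    count-∈ x∈xs px = ∈-length (∈-filter⁺ P? x∈xs px)

    choose : ∀ c xs → c ≤ count P? xs →
      ∃₂ λ ys zs → xs ↭ ys ++ zs × length ys ≡ c × All P ys
    choose 0 xs _ = [] , xs , refl , refl , []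
    choose (suc c) (x ∷ xs) c≤ with P? x
    ... | yes px with ys , zs , σ , len , pys ← choose c xs (≤-pred c≤) =
      x ∷ ys , zs , prep x σ , cong suc len , px ∷ pys
    ... | no _ with ys , zs , σ , len , pys ← choose (suc c) xs c≤ =
      ys , x ∷ zs , trans (prep x σ) (↭-sym (shift x ys zs)) , len , pys

  module _ {P Q S : Pred A 0ℓ} (P? : Decidable P) (Q? : Decidable Q) (S? : Decidable S) where

    count-∪ : (∀ {x} → P x → Q x ⊎ S x) → ∀ xs → count P? xs ≤ count Q? xs + count S? xs
    count-∪ P⊆Q∪S [] = z≤n
    count-∪ P⊆Q∪S (x ∷ xs) with ih ← count-∪ P⊆Q∪S xs | P? x | Q? x | S? x
    ... | yes _ | yes _ | yes _ = s≤s (≤-trans ih (+-monoʳ-≤ (count Q? xs) (n≤1+n _)))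
    ... | yes _ | yes _ | no _ = s≤s ih
    ... | yes _ | no _ | yes _ = subst (suc (count P? xs) ≤_) (≡-sym (+-suc _ _)) (s≤s ih)
    ... | yes p | no ¬q | no ¬s = ⊥-elim ([ ¬q , ¬s ]′ (P⊆Q∪S p))
    ... | no _ | yes _ | yes _ = m≤n⇒m≤1+n (≤-trans ih (+-monoʳ-≤ (count Q? xs) (n≤1+n _)))
    ... | no _ | yes _ | no _ = m≤n⇒m≤1+n ih
    ... | no _ | no _ | yes _ = ≤-trans ih (+-monoʳ-≤ (count Q? xs) (n≤1+n _))
    ... | no _ | no _ | no _ = ih

    count-⊎ : (∀ {x} → P x → S x) → (∀ {x} → Q x → S x) → (∀ {x} → P x → ¬ Q x) →
      ∀ xs → count P? xs + count Q? xs ≤ count S? xs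
    count-⊎ P⊆S Q⊆S P∩Q=∅ [] = z≤n
    count-⊎ P⊆S Q⊆S P∩Q=∅ (x ∷ xs)
      with ih ← count-⊎ P⊆S Q⊆S P∩Q=∅ xs | P? x | Q? x | S? x
    ... | yes p | yes q | _ = ⊥-elim (P∩Q=∅ p q)
    ... | yes p | no _ | no ¬s = ⊥-elim (¬s (P⊆S p))
    ... | no _ | yes q | no ¬s = ⊥-elim (¬s (Q⊆S q))
    ... | yes _ | no _ | yes _ = s≤s ih
    ... | no _ | yes _ | yes _ = subst (_≤ suc (count S? xs)) (≡-sym (+-suc _ _)) (s≤s ih)
    ... | no _ | no _ | yes _ = m≤n⇒m≤1+n ih
    ... | no _ | no _ | no _ = ih

-- Pigeonhole: subtracting `a` from the entries maps the positions of `xs` injectively into `Fin c`.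
length-≤-interval : ∀ {n} {xs : List (Fin n)} a c → Unique xs →
  (∀ {j} → j ∈ xs → a ≤ toℕ j × toℕ j < a + c) → length xs ≤ c
length-≤-interval {xs = xs} a c u within = injective⇒≤ {f = f} f-injective
  where
  lower : ∀ i → a ≤ toℕ (lookup xs i)
  lower i = proj₁ (within (∈-lookup i))

  upper : ∀ i → toℕ (lookup xs i) ∸ a < c
  upper i = +-cancelˡ-< a _ _
    (subst (_< a + c) (≡-sym (m+[n∸m]≡n (lower i))) (proj₂ (within (∈-lookup i))))

  f : Fin (length xs) → Fin c
  f i = fromℕ< (upper i)

  f-injective : ∀ {i j} → f i ≡ f j → i ≡ j
  f-injective {i} {j} eq = lookup-unique-injective u i j
    (toℕ-injective (∸-cancelʳ-≡ (lower i) (lower j)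
      (≡-trans (≡-sym (toℕ-fromℕ< (upper i))) (≡-trans (cong toℕ eq) (toℕ-fromℕ< (upper j))))))

count-≤-interval : ∀ {n} {P : Pred (Fin n) 0ℓ} (P? : Decidable P) {xs} a c → Unique xs →
  (∀ {j} → j ∈ xs → P j → a ≤ toℕ j × toℕ j < a + c) → count P? xs ≤ c
count-≤-interval P? a c u within = length-≤-interval a c (Unique.filter⁺ P? u)
  λ j∈ → let j∈xs , pj = ∈-filter⁻ P? j∈ in within j∈xs pj

-- The greedy invariant and its preservation.

module Greedy {n} (G : Graph n) (k ℓ : ℕ) (bandwidth : Bandwidth≤ G k) (z : Fin n) where

  V : Set
  V = Fin n

  Adj? : ∀ i j → Dec (Adj G i j)
  Adj? i j = T? (adj G i j)

  Adj-sym : ∀ {i j} → Adj G i j → Adj G j i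
  Adj-sym {i} {j} = subst T (Graph.sym G i j)

  Adj⇒≤ : ∀ {i j} → Adj G i j → toℕ j ≤ toℕ i + k
  Adj⇒≤ {i} {j} i~j = ≤-trans (m≤n+∣n-m∣ (toℕ j) (toℕ i)) (+-monoʳ-≤ (toℕ i) (bandwidth i j i~j))

  -- Gaps are cut off at distance `k` so that the left neighbours and the gaps of `i` together fit
  -- into the at most `k` places just before `i`; many left neighbours then mean few gaps.
  Right Gap : V → Pred V 0ℓ
  Right i j = toℕ i < toℕ j × Adj G i j
  Gap i j = toℕ j < toℕ i × toℕ i ≤ toℕ j + k × ¬ Adj G i j

  right? : ∀ i → Decidable (Right i)
  right? i j = toℕ i <? toℕ j ×-dec Adj? i j

  gap? : ∀ i → Decidable (Gap i)
  gap? i j = toℕ j <? toℕ i ×-dec toℕ i ≤? toℕ j + k ×-dec ¬? (Adj? i j)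

  ρ μ : V → List V → ℕ
  ρ i = count (right? i)
  μ i = count (gap? i)

  -- z is the common last vertex of all ℓ paths, so an edge to it counts ℓ times.
  bonus : V → ℕ
  bonus i = if adj G i z then ℓ else 0

  bonus-≤ : ∀ i → bonus i ≤ ℓ
  bonus-≤ i with adj G i z
  ... | true = ≤-refl
  ... | false = z≤n

  bonus-yes : ∀ {i} → Adj G i z → bonus i ≡ ℓ
  bonus-yes {i} i~z with adj G i z
  ... | true = refl

  bonus-no : ∀ {i} → ¬ Adj G i z → bonus i ≡ 0
  bonus-no {i} i≁z with adj G i z
  ... | true = ⊥-elim (i≁z tt)
  ... | false = refl

  -- `few` is only an upper bound because ends that have stopped leave `E`. The common endpoint `z`
  -- is kept out of both lists and enters through `bonus`. The extra 1 in `ahead` pays for a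
  -- neighbour lost from `ρ` later on.
  record State (E R : List V) : Set where
    field
      few    : length E ≤ ℓ
      unique : Unique (E ++ R)
      below  : All (λ i → toℕ i < toℕ z) (E ++ R)
      base   : ∀ {i} → i ∈ E ++ R → μ i (E ++ R) + ℓ ≤ ρ i (E ++ R) + bonus i
      ahead  : ∀ {i} → i ∈ R → All (λ e → toℕ i < toℕ e) E →
               suc (μ i (E ++ R) + ℓ) ≤ ρ i (E ++ R) + bonus i

  open State

  State-resp-↭ : ∀ {E E′ R R′} → E ↭ E′ → R ↭ R′ → State E R → State E′ R′
  State-resp-↭ {E} {E′} {R} {R′} σ τ st = record
    { few    = subst (_≤ ℓ) (↭-length σ) (few st)
    ; unique = Unique-resp-↭ στ (unique st)
    ; below  = All-resp-↭ στ (below st)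
    ; base   = λ {i} i∈ → transport i (λ m r → m + ℓ ≤ r + bonus i)
                 (base st (∈-resp-↭ (↭-sym στ) i∈))
    ; ahead  = λ {i} i∈ i<E → transport i (λ m r → suc (m + ℓ) ≤ r + bonus i)
                 (ahead st (∈-resp-↭ (↭-sym τ) i∈) (All-resp-↭ (↭-sym σ) i<E))
    }
    where
    στ : E ++ R ↭ E′ ++ R′
    στ = ++⁺ σ τ

    transport : ∀ i (C : ℕ → ℕ → Set) →
      C (μ i (E ++ R)) (ρ i (E ++ R)) → C (μ i (E′ ++ R′)) (ρ i (E′ ++ R′))
    transport i C = subst₂ C (count-↭ (gap? i) στ) (count-↭ (right? i) στ)

  -- Dropping e lowers ρ i only for i < e adjacent to e; such an i satisfied the stronger bound
  -- "ahead" and is no longer ahead of all ends afterwards.  Conversely, if i > e becomes ahead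
  -- of all ends, then e was one of the gaps of i.
  discard : ∀ {e E R E′ R′} → State (e ∷ E) R → All (λ e′ → toℕ e ≤ toℕ e′) E →
    length E′ ≤ ℓ → E ++ R ↭ E′ ++ R′ →
    (∀ {i} → i ∈ R′ → All (λ e′ → toℕ i < toℕ e′) E′ → ¬ Adj G i e × toℕ i ≤ toℕ e + k) →
    State E′ R′
  discard {e} {E} {R} {E′} {R′} st e≤E few′ σ fringe with e∉ ∷ unique-W ← unique st = record
    { few    = few′
    ; unique = Unique-resp-↭ σ unique-W
    ; below  = All-resp-↭ σ (All.tail (below st))
    ; base   = λ {i} i∈ → subst₂ (λ m r → m + ℓ ≤ r + bonus i)
                 (count-↭ (gap? i) σ) (count-↭ (right? i) σ) (base′ (∈-resp-↭ (↭-sym σ) i∈))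
    ; ahead  = λ {i} i∈ i<E′ → subst₂ (λ m r → suc (m + ℓ) ≤ r + bonus i)
                 (count-↭ (gap? i) σ) (count-↭ (right? i) σ)
                 (ahead′ (∈-resp-↭ (↭-sym σ) (∈-++⁺ʳ E′ i∈)) (fringe i∈ i<E′))
    }
    where
    W = E ++ R

    ahead-before : ∀ {i} → i ∈ W → toℕ i < toℕ e →
      suc (μ i W + ℓ) ≤ ρ i (e ∷ W) + bonus i
    ahead-before {i} i∈ i<e with ∈-++⁻ E i∈
    ... | inj₁ i∈E = ⊥-elim (<⇒≱ i<e (All.lookup e≤E i∈E))
    ... | inj₂ i∈R = ≤-trans (s≤s (+-monoˡ-≤ ℓ (count-≤-∷ (gap? i) e W)))
                       (ahead st i∈R (i<e ∷ All.map (<-≤-trans i<e) e≤E))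

    base′ : ∀ {i} → i ∈ W → μ i W + ℓ ≤ ρ i W + bonus i
    base′ {i} i∈ with <-cmp (toℕ i) (toℕ e)
    ... | tri< i<e _ _ = ≤-pred (≤-trans (ahead-before i∈ i<e)
                           (+-monoˡ-≤ (bonus i) (count-∷-≤ (right? i) e W)))
    ... | tri≈ _ i≡e _ = ⊥-elim (All.lookup e∉ i∈ (≡-sym (toℕ-injective i≡e)))
    ... | tri> i≮e _ _ = ≤-trans (+-monoˡ-≤ ℓ (count-≤-∷ (gap? i) e W))
                           (subst (λ r → μ i (e ∷ W) + ℓ ≤ r + bonus i)
                             (count-no (right? i) W (i≮e ∘ proj₁)) (base st (there i∈)))

    ahead′ : ∀ {i} → i ∈ W → ¬ Adj G i e × toℕ i ≤ toℕ e + k →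
      suc (μ i W + ℓ) ≤ ρ i W + bonus i
    ahead′ {i} i∈ (i≁e , i≤e+k) with <-cmp (toℕ i) (toℕ e)
    ... | tri< i<e _ _ = subst (λ r → suc (μ i W + ℓ) ≤ r + bonus i)
                           (count-no (right? i) W (i≁e ∘ proj₂)) (ahead-before i∈ i<e)
    ... | tri≈ _ i≡e _ = ⊥-elim (All.lookup e∉ i∈ (≡-sym (toℕ-injective i≡e)))
    ... | tri> i≮e _ e<i = subst₂ (λ m r → m + ℓ ≤ r + bonus i)
                           (count-yes (gap? i) W (e<i , i≤e+k , i≁e))
                           (count-no (right? i) W (i≮e ∘ proj₁)) (base st (there i∈))

  -- Completing the paths from the current ends to `z`.

  path : V × List V → List V
  path (v , vs) = v ∷ vs

  -- The solution of what remains: continuations of the ends in `E` up to `z` that partition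
  -- `E ++ R`. Visited vertices are forgotten, so the paths are assembled backwards as the recursion
  -- returns. Disjointness is contained in the permutation, since `E ++ R` has no repetitions in a
  -- `State`.
  Cover : List V → List V → Set
  Cover E R = ∃ λ qs → map proj₁ qs ↭ E × concatMap path qs ↭ E ++ R ×
    All (λ q → Linked (Adj G) (path q ++ [ z ])) qs

  Cover-resp-↭ : ∀ {E E′ R R′} → E ↭ E′ → R ↭ R′ → Cover E R → Cover E′ R′
  Cover-resp-↭ σ τ (qs , heads , covers , linked) =
    qs , trans heads σ , trans covers (++⁺ σ τ) , linked

  Cover-stop : ∀ {e E R} → Adj G e z → Cover E R → Cover (e ∷ E) R
  Cover-stop {e} e~z (qs , heads , covers , linked) =
    (e , []) ∷ qs , prep e heads , prep e covers , (e~z ∷ [-]) ∷ linked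

  Cover-extend : ∀ {e w E R} → Adj G e w → Cover (w ∷ E) R → Cover (e ∷ E) (w ∷ R)
  Cover-extend {e} {w} {E} {R} e~w (qs , heads , covers , linked)
    -- Some path starts at `w`; inverting the permutation of heads brings it to the front, where `e`
    -- can be prepended.
    with q ∷ qs′ , refl , σ ← ↭-map-inv proj₁ heads
    with q-linked ∷ linked′ ← All-resp-↭ σ linked =
    (e , path q) ∷ qs′ , refl ,
    prep e (trans (↭-sym (concatMap-↭ path σ)) (trans covers (↭-sym (shift w E R)))) ,
    (e~w ∷ q-linked) ∷ linked′

  -- With no ends, every unvisited vertex is vacuously ahead of them all. The last one has no
  -- neighbour to its right in `R`, so only its bonus of at most `ℓ` is left, too little for the
  -- strict bound.
  complete : ∀ {R} → State [] R → R ≡ []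
  -- Minimising `n ∸ toℕ i` picks the rightmost vertex.
  complete {R} st with least {P = λ _ → ⊤} (λ _ → yes tt) (λ i → n ∸ toℕ i) R
  ... | inj₁ none = case none of λ { [] → refl ; (¬⊤ ∷ _) → ⊥-elim (¬⊤ tt) }
  ... | inj₂ (r , ys , σ , _ , max) = ⊥-elim (<⇒≱ (ahead st r∈R []) (≤-trans bound (m≤n+m ℓ (μ r R))))
    where
    r∈R : r ∈ R
    r∈R = ∈-resp-↭ (↭-sym σ) (here refl)

    r-last : All (λ y → ¬ Right r y) (r ∷ ys)
    r-last = (<-irrefl refl ∘ proj₁) ∷
      All.map (λ {y} h (r<y , _) → <⇒≱ (∸-monoʳ-< r<y (<⇒≤ (toℕ<n y))) (h tt)) max

    bound : ρ r R + bonus r ≤ ℓ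
    bound = subst (λ x → x + bonus r ≤ ℓ)
      (≡-sym (≡-trans (count-↭ (right? r) σ) (count-none (right? r) r-last))) (bonus-≤ r)

  -- The leftmost end e competes with fewer than ℓ other ends.
  not-stuck : ∀ {e E R} → State (e ∷ E) R → All (¬_ ∘ Adj G e) R → Adj G e z
  not-stuck {e} {E} {R} st none with Adj? e z
  ... | yes e~z = e~z
  ... | no e≁z = ⊥-elim (<⇒≱ (few st) (begin
    ℓ                                  ≤⟨ m≤n+m ℓ _ ⟩
    μ e (e ∷ E ++ R) + ℓ               ≤⟨ base st (here refl) ⟩
    ρ e (e ∷ E ++ R) + bonus e         ≡⟨ cong₂ _+_ (count-no (right? e) (E ++ R) (<-irrefl refl ∘ proj₁))
                                                   (bonus-no e≁z) ⟩
    ρ e (E ++ R) + 0                   ≡⟨ +-identityʳ _ ⟩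
    ρ e (E ++ R)                       ≡⟨ cong length (filter-++ (right? e) E R) ⟩
    length (filter (right? e) E ++ filter (right? e) R)
                                       ≡⟨ length-++ (filter (right? e) E) ⟩
    ρ e E + ρ e R                      ≡⟨ cong (ρ e E +_)
                                            (count-none (right? e) (All.map (_∘ proj₂) none)) ⟩
    ρ e E + 0                          ≡⟨ +-identityʳ _ ⟩
    ρ e E                              ≤⟨ length-filter (right? e) E ⟩
    length E                           ∎))
    where open ≤-Reasoning

  -- The recursion is on the number `s` of vertices in `E ++ R`: a stop and a move both remove
  -- exactly `e`, as the next end `w` merely passes from `R` to `E`.
  greedy : ∀ s {E R} → length (E ++ R) ≡ s → State E R → Cover E R
  greedy s {E} {R} size st with least {P = λ _ → ⊤} (λ _ → yes tt) toℕ E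
  greedy s {[]} size st | inj₁ _ with refl ← complete st = [] , refl , refl , []
  greedy s {_ ∷ _} size st | inj₁ (¬⊤ ∷ _) = ⊥-elim (¬⊤ tt)
  greedy s {E} {R} size st | inj₂ (e , E₀ , σ , _ , min) = Cover-resp-↭ (↭-sym σ) refl
    (advance s (≡-trans (≡-sym (↭-length (++⁺ʳ R σ))) size) (least (Adj? e) toℕ R))
    where
    st₀ : State (e ∷ E₀) R
    st₀ = State-resp-↭ σ refl st

    e≤E₀ : All (λ e′ → toℕ e ≤ toℕ e′) E₀
    e≤E₀ = All.map (λ h → h tt) min

    advance : ∀ s → length (e ∷ E₀ ++ R) ≡ s →
      All (¬_ ∘ Adj G e) R ⊎
        (∃₂ λ w R₀ → R ↭ w ∷ R₀ × Adj G e w × All (λ y → Adj G e y → toℕ w ≤ toℕ y) R₀) →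
      Cover (e ∷ E₀) R
    -- No unvisited vertex is adjacent to `e`, and all lie before `z`, which as a neighbour of `e`
    -- is at most `k` to its right.
    advance (suc s) size₀ (inj₁ none) = Cover-stop e~z (greedy s (suc-injective size₀)
      (discard st₀ e≤E₀ (<⇒≤ (few st₀)) refl λ i∈R _ →
        All.lookup none i∈R ∘ Adj-sym ,
        ≤-trans (<⇒≤ (All.lookup (below st₀) (there (∈-++⁺ʳ E₀ i∈R)))) (Adj⇒≤ e~z)))
      where
      e~z : Adj G e z
      e~z = not-stuck st₀ none
    -- A vertex ahead of all new ends is left of `w`, hence no neighbour of `e` by the choice of
    -- `w`, and at most `k` to the right of `e` because `w` is.
    advance (suc s) size₀ (inj₂ (w , R₀ , τ , e~w , w-min)) = Cover-resp-↭ refl (↭-sym τ)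
      (Cover-extend e~w (greedy s (≡-trans (≡-sym (↭-length reorder)) (suc-injective size₀))
        (discard st₀ e≤E₀ (few st₀) reorder λ { i∈R₀ (i<w ∷ _) →
          (λ i~e → <⇒≱ i<w (All.lookup w-min i∈R₀ (Adj-sym i~e))) ,
          ≤-trans (<⇒≤ i<w) (Adj⇒≤ e~w) })))
      where
      reorder : E₀ ++ R ↭ w ∷ E₀ ++ R₀
      reorder = trans (++⁺ˡ E₀ τ) (shift w E₀ R₀)

-- The degree condition yields the initial invariant.

module Roots {n} (G : Graph n) (k ℓ : ℕ) (1≤ℓ : 1 ≤ ℓ) (ℓ+2≤n : ℓ + 2 ≤ n) (bandwidth : Bandwidth≤ G k)
  (degrees : ∀ a → (ℓ + toℕ a) ⊓ ((k + ℓ) ⊓ (k + (n ∸ suc (toℕ a)))) ≤ deg G a)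
  (v₁ z : Fin n) (v₁≡0 : toℕ v₁ ≡ 0) (z≡n-1 : suc (toℕ z) ≡ n) where

  open Greedy G k ℓ bandwidth z

  v₁≢z : v₁ ≢ z
  v₁≢z v₁≡z = <⇒≱ (≤-trans (+-monoˡ-≤ 2 1≤ℓ) ℓ+2≤n)
    (subst (_≤ 2) (≡-trans (cong suc (≡-trans (≡-sym v₁≡0) (cong toℕ v₁≡z))) z≡n-1) (s≤s z≤n))

  interior : ∃ λ I → allFin n ↭ z ∷ v₁ ∷ I
  interior with X , σ ← ∈⇒↭∷ (∈-allFin z) with ∈-resp-↭ σ (∈-allFin v₁)
  ... | here v₁≡z = ⊥-elim (v₁≢z v₁≡z)
  ... | there v₁∈X with I , τ ← ∈⇒↭∷ v₁∈X = I , trans σ (prep z τ)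

  I : List V
  I = proj₁ interior

  allFin↭ : allFin n ↭ z ∷ v₁ ∷ I
  allFin↭ = proj₂ interior

  z,v₁,I-unique : Unique (z ∷ v₁ ∷ I)
  z,v₁,I-unique = Unique-resp-↭ allFin↭ (Unique.allFin⁺ n)

  ≢z⇒<z : ∀ {i} → z ≢ i → toℕ i < toℕ z
  ≢z⇒<z {i} z≢i = ≤∧≢⇒< (≤-pred (subst (toℕ i <_) (≡-sym z≡n-1) (toℕ<n i)))
    (z≢i ∘ ≡-sym ∘ toℕ-injective)

  <z : All (λ i → toℕ i < toℕ z) (v₁ ∷ I)
  <z with z∉ ∷ _ ← z,v₁,I-unique = All.map ≢z⇒<z z∉

  Left Window : V → Pred V 0ℓ
  Left i j = toℕ j < toℕ i × Adj G i j
  Window i j = toℕ j < toℕ i × toℕ i ≤ toℕ j + k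

  left? : ∀ i → Decidable (Left i)
  left? i j = toℕ j <? toℕ i ×-dec Adj? i j

  window? : ∀ i → Decidable (Window i)
  window? i j = toℕ j <? toℕ i ×-dec toℕ i ≤? toℕ j + k

  leftdeg : V → ℕ
  leftdeg i = count (left? i) (allFin n)

  Adj⇒Left⊎Right : ∀ {i j} → Adj G i j → Left i j ⊎ Right i j
  Adj⇒Left⊎Right {i} {j} i~j with <-cmp (toℕ i) (toℕ j)
  ... | tri< i<j _ _ = inj₂ (i<j , i~j)
  ... | tri≈ _ i≡j _ = ⊥-elim (subst T (Graph.irrefl G i)
                         (subst (Adj G i) (≡-sym (toℕ-injective i≡j)) i~j))
  ... | tri> _ _ j<i = inj₁ (j<i , i~j)

  deg-≤ : ∀ i → deg G i ≤ leftdeg i + ρ i (allFin n)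
  deg-≤ i = count-∪ (Adj? i) (left? i) (right? i) Adj⇒Left⊎Right (allFin n)

  -- By the bandwidth bound the left neighbours lie in the window, and the gaps are its
  -- non-neighbours.
  leftdeg+μ-≤ : ∀ i → leftdeg i + μ i (allFin n) ≤ count (window? i) (allFin n)
  leftdeg+μ-≤ i = count-⊎ (left? i) (gap? i) (window? i)
    (λ (j<i , i~j) → j<i , Adj⇒≤ (Adj-sym i~j))
    (λ (j<i , i≤j+k , _) → j<i , i≤j+k)
    (λ (_ , i~j) (_ , _ , i≁j) → i≁j i~j)
    (allFin n)

  -- This bound and `window-≤-k` match the first two terms of the degree minimum, each of which is
  -- `ℓ` plus a bound on the window.
  window-≤-toℕ : ∀ i → count (window? i) (allFin n) ≤ toℕ i
  window-≤-toℕ i = count-≤-interval (window? i) 0 (toℕ i) (Unique.allFin⁺ n)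
    λ _ (j<i , _) → z≤n , j<i

  window-≤-k : ∀ i → count (window? i) (allFin n) ≤ k
  window-≤-k i = count-≤-interval (window? i) (toℕ i ∸ k) k (Unique.allFin⁺ n)
    λ {j} _ (j<i , i≤j+k) →
      m≤n+o⇒m∸n≤o (toℕ i) k (subst (toℕ i ≤_) (+-comm (toℕ j) k) i≤j+k) ,
      <-≤-trans j<i (subst (toℕ i ≤_) (+-comm k _) (m≤n+m∸n (toℕ i) k))

  -- Strict because `z` is one of the `n ∸ suc (toℕ i)` vertices to the right of `i` but is missing
  -- from `v₁ ∷ I`.
  ρ-≤ : ∀ i → toℕ i < toℕ z → ρ i (v₁ ∷ I) < n ∸ suc (toℕ i)
  ρ-≤ i i<z = ≤-<-trans
    (count-≤-interval (right? i) (suc (toℕ i)) (toℕ z ∸ suc (toℕ i)) (Unique.drop⁺ 1 z,v₁,I-unique)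
      λ {j} j∈ (i<j , _) → i<j ,
        subst (toℕ j <_) (≡-sym (m+[n∸m]≡n i<z)) (All.lookup <z j∈))
    (subst (λ m → toℕ z ∸ suc (toℕ i) < m ∸ suc (toℕ i)) z≡n-1 (∸-monoʳ-< (n<1+n (toℕ i)) i<z))

  -- Used with `a` the left degree, `b` the gaps, `c` the window bound and `x` the right degree:
  -- surplus degree beyond the window must lie on the right.
  cancel : ∀ {a b c d x} → a + b ≤ c → d + c ≤ a + x → b + d ≤ x
  cancel {a} {b} {c} {d} {x} a+b≤c d+c≤a+x = +-cancelˡ-≤ a (b + d) x (begin
    a + (b + d) ≡⟨ +-assoc a b d ⟨
    a + b + d   ≤⟨ +-monoˡ-≤ d a+b≤c ⟩
    c + d       ≡⟨ +-comm c d ⟩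
    d + c       ≤⟨ d+c≤a+x ⟩
    a + x       ∎)
    where open ≤-Reasoning

  -- The left degree is at most the window minus the gaps, so the right degree is at least `deg G i`
  -- minus the window plus the gaps. The first two terms of the minimum give the surplus `ℓ`
  -- directly. The third makes every vertex to the right a neighbour and leaves no gap; then the
  -- edge to `z` contributes `ℓ` by itself.
  base-bound : ∀ i → toℕ i < toℕ z → μ i (v₁ ∷ I) + ℓ ≤ ρ i (v₁ ∷ I) + bonus i
  base-bound i i<z = case m⊓n≤o⇒m≤o⊎n≤o (ℓ + toℕ i) _ (degrees i) of λ
    { (inj₁ ℓ+i≤deg) → from-window (window-≤-toℕ i) ℓ+i≤deg
    ; (inj₂ rest) → case m⊓n≤o⇒m≤o⊎n≤o (k + ℓ) _ rest of λ
      { (inj₁ k+ℓ≤deg) → from-window (window-≤-k i) (subst (_≤ deg G i) (+-comm k ℓ) k+ℓ≤deg)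
      ; (inj₂ k+m≤deg) → near-end (Adj? i z) (cancel (≤-trans (leftdeg+μ-≤ i) (window-≤-k i))
          (≤-trans (subst (_≤ deg G i) (+-comm k m) k+m≤deg) (deg-≤ i)))
      } }
    where
    U = v₁ ∷ I
    m = n ∸ suc (toℕ i)

    Goal = μ i U + ℓ ≤ ρ i U + bonus i

    μ-allFin : μ i (allFin n) ≡ μ i U
    μ-allFin = ≡-trans (count-↭ (gap? i) allFin↭) (count-no (gap? i) U (<⇒≯ i<z ∘ proj₁))

    ρ-yes : Adj G i z → ρ i (allFin n) ≡ suc (ρ i U)
    ρ-yes i~z = ≡-trans (count-↭ (right? i) allFin↭) (count-yes (right? i) U (i<z , i~z))

    ρ-no : ¬ Adj G i z → ρ i (allFin n) ≡ ρ i U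
    ρ-no i≁z = ≡-trans (count-↭ (right? i) allFin↭) (count-no (right? i) U (i≁z ∘ proj₂))

    -- An edge to `z` counts once on the left and `ℓ ≥ 1` times on the right.
    ρ-allFin-≤ : Dec (Adj G i z) → ρ i (allFin n) ≤ ρ i U + bonus i
    ρ-allFin-≤ (no i≁z) = subst (_≤ ρ i U + bonus i) (≡-sym (ρ-no i≁z)) (m≤m+n _ _)
    ρ-allFin-≤ (yes i~z) = subst₂ (λ x b → x ≤ ρ i U + b) (≡-sym (ρ-yes i~z)) (≡-sym (bonus-yes i~z))
      (subst (_≤ ρ i U + ℓ) (+-comm (ρ i U) 1) (+-monoʳ-≤ (ρ i U) 1≤ℓ))

    from-window : ∀ {w} → count (window? i) (allFin n) ≤ w → ℓ + w ≤ deg G i → Goal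
    from-window window≤w ℓ+w≤deg = subst (λ x → x + ℓ ≤ ρ i U + bonus i) μ-allFin
      (≤-trans (cancel (≤-trans (leftdeg+μ-≤ i) window≤w) (≤-trans ℓ+w≤deg (deg-≤ i)))
        (ρ-allFin-≤ (Adj? i z)))

    -- There are only `m` vertices to the right of `i`, one of them `z`. So `h` fails without the
    -- edge to `z`, and with it leaves no room for a gap.
    near-end : Dec (Adj G i z) → μ i (allFin n) + m ≤ ρ i (allFin n) → Goal
    near-end (no i≁z) h =
      ⊥-elim (<⇒≱ (ρ-≤ i i<z) (≤-trans (m≤n+m m _) (≤-trans h (≤-reflexive (ρ-no i≁z)))))
    near-end (yes i~z) h = subst₂ (λ x b → x + ℓ ≤ ρ i U + b)
      (≡-trans (≡-sym (n≤0⇒n≡0 μ≤0)) μ-allFin) (≡-sym (bonus-yes i~z)) (m≤n+m ℓ _)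
      where
      μ≤0 : μ i (allFin n) ≤ 0
      μ≤0 = +-cancelʳ-≤ m _ 0 (≤-trans h (subst (_≤ m) (≡-sym (ρ-yes i~z)) (ρ-≤ i i<z)))

  -- Taking `v₁` as the only end makes its replacement by `ℓ` ends an instance of `discard`. No
  -- vertex is left of `v₁`, so `ahead` is vacuous.
  initial : State [ v₁ ] I
  initial with _ ∷ unique-v₁,I ← z,v₁,I-unique = record
    { few    = 1≤ℓ
    ; unique = unique-v₁,I
    ; below  = <z
    ; base   = λ i∈ → base-bound _ (All.lookup <z i∈)
    ; ahead  = λ { _ (i<v₁ ∷ []) → ⊥-elim (n≮0 (subst (_ <_) v₁≡0 i<v₁)) }
    }

  -- The neighbours of `v₁` and the first step.

  ℓ≤deg-v₁ : ℓ ≤ deg G v₁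
  ℓ≤deg-v₁ = ≤-trans (⊓-glb (m≤m+n ℓ _) (⊓-glb (m≤n+m ℓ k) (≤-trans ℓ≤n-1 (m≤n+m _ k)))) (degrees v₁)
    where
    ℓ≤n-1 : ℓ ≤ n ∸ suc (toℕ v₁)
    ℓ≤n-1 = subst (λ x → ℓ ≤ n ∸ suc x) (≡-sym v₁≡0)
      (m+n≤o⇒m≤o∸n ℓ (≤-trans (+-monoʳ-≤ ℓ (s≤s z≤n)) ℓ+2≤n))

  deg<n : ∀ y → deg G y < n
  deg<n y with Y , σ ← ∈⇒↭∷ (∈-allFin y) = begin-strict
    deg G y              ≡⟨ ≡-trans (count-↭ (Adj? y) σ)
                              (count-no (Adj? y) Y (subst T (Graph.irrefl G y))) ⟩
    count (Adj? y) Y     ≤⟨ length-filter (Adj? y) Y ⟩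
    length Y             <⟨ n<1+n _ ⟩
    length (y ∷ Y)       ≡⟨ ↭-length σ ⟨
    length (allFin n)    ≡⟨ length-tabulate {n = n} (λ i → i) ⟩
    n                    ∎
    where open ≤-Reasoning

  -- If v₁ and v_n are adjacent, then n ≤ k + 1, and the degree of v_{n-1} forces ℓ = 1.
  module Short (v₁~z : Adj G v₁ z) where

    n≤1+k : n ≤ suc k
    n≤1+k = subst₂ (λ a b → a ≤ suc (b + k)) z≡n-1 v₁≡0 (s≤s (Adj⇒≤ v₁~z))

    3≤n : 3 ≤ n
    3≤n = ≤-trans (+-monoˡ-≤ 2 1≤ℓ) ℓ+2≤n

    y : V
    y = fromℕ< {n ∸ 2} (∸-monoʳ-< {n} {2} {0} z<s (<⇒≤ 3≤n))

    2+y≡n : 2 + toℕ y ≡ n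
    2+y≡n = ≡-trans (cong (2 +_) (toℕ-fromℕ< _)) (m+[n∸m]≡n (<⇒≤ 3≤n))

    n∸1+y≡1 : n ∸ suc (toℕ y) ≡ 1
    n∸1+y≡1 = ≡-trans (cong (_∸ suc (toℕ y)) (≡-sym 2+y≡n)) (m+n∸n≡m 1 (suc (toℕ y)))

    y<z : toℕ y < toℕ z
    y<z = ≤-reflexive (suc-injective (≡-trans 2+y≡n (≡-sym z≡n-1)))

    v₁<y : toℕ v₁ < toℕ y
    v₁<y = subst (_< toℕ y) (≡-sym v₁≡0) (≤-pred (≤-pred (subst (3 ≤_) (≡-sym 2+y≡n) 3≤n)))

    y∈I : y ∈ I
    y∈I with ∈-resp-↭ allFin↭ (∈-allFin y)
    ... | here y≡z = ⊥-elim (<-irrefl (cong toℕ y≡z) y<z)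
    ... | there (here y≡v₁) = ⊥-elim (<-irrefl (cong toℕ (≡-sym y≡v₁)) v₁<y)
    ... | there (there y∈) = y∈

    -- Only `z` is to the right of `y`, so `base-bound` allows `y` no gap; but `v₁` is within
    -- distance `k` of `z`, hence of `y`, and would be one.
    v₁~y : Adj G v₁ y
    v₁~y with Adj? y v₁
    ... | yes y~v₁ = Adj-sym y~v₁
    ... | no y≁v₁ = ⊥-elim (<⇒≱ gap (≤-trans (+-cancelʳ-≤ ℓ _ _ (≤-trans (base-bound y y<z)
            (+-monoʳ-≤ (ρ y (v₁ ∷ I)) (bonus-≤ y)))) ρ≤0))
      where
      ρ≤0 : ρ y (v₁ ∷ I) ≤ 0
      ρ≤0 = ≤-pred (subst (ρ y (v₁ ∷ I) <_) n∸1+y≡1 (ρ-≤ y y<z))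

      y≤v₁+k : toℕ y ≤ toℕ v₁ + k
      y≤v₁+k = ≤-trans (<⇒≤ y<z) (Adj⇒≤ v₁~z)

      gap : 0 < μ y (v₁ ∷ I)
      gap = count-∈ (gap? y) (here refl) (v₁<y , y≤v₁+k , y≁v₁)

    -- Here `deg G y ≤ n ∸ 1 ≤ k`. The first term of the minimum is `ℓ + (n ∸ 2)` and gives the
    -- claim, the second would make `ℓ` zero, and the third, `k + 1`, is too large.
    ℓ≤1 : ℓ ≤ 1
    ℓ≤1 = case m⊓n≤o⇒m≤o⊎n≤o (ℓ + toℕ y) _ (degrees y) of λ
      { (inj₁ h) → +-cancelʳ-≤ (suc (toℕ y)) ℓ 1
          (subst₂ _≤_ (≡-sym (+-suc ℓ (toℕ y))) (≡-sym 2+y≡n) (≤-<-trans h (deg<n y)))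
      ; (inj₂ rest) → case m⊓n≤o⇒m≤o⊎n≤o (k + ℓ) _ rest of λ
        { (inj₁ h) → ≤-trans
            (+-cancelˡ-≤ k ℓ 0 (subst (k + ℓ ≤_) (≡-sym (+-identityʳ k)) (deg≤k h))) z≤n
        ; (inj₂ h) → ⊥-elim (<⇒≱ (n<1+n k)
            (subst (_≤ k) (≡-trans (cong (k +_) n∸1+y≡1) (+-comm k 1)) (deg≤k h)))
        } }
      where
      deg≤k : ∀ {x} → x ≤ deg G y → x ≤ k
      deg≤k h = ≤-pred (≤-trans (≤-<-trans h (deg<n y)) n≤1+k)

  -- Each path needs an interior vertex, so `z` cannot serve as a first step. If it is a neighbour
  -- of `v₁`, one path is to be found and `y` serves instead.
  enough : ℓ ≤ count (Adj? v₁) I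
  enough with Adj? v₁ z
  ... | yes v₁~z = ≤-trans ℓ≤1 (count-∈ (Adj? v₁) y∈I v₁~y)
    where open Short v₁~z
  ... | no v₁≁z = subst (ℓ ≤_) (≡-trans (count-↭ (Adj? v₁) allFin↭)
        (≡-trans (count-no (Adj? v₁) (v₁ ∷ I) v₁≁z)
          (count-no (Adj? v₁) I (subst T (Graph.irrefl G v₁))))) ℓ≤deg-v₁

  first-step : ∃₂ λ E R → length E ≡ ℓ × All (Adj G v₁) E × I ↭ E ++ R × Cover E R
  first-step with least (Adj? v₁) toℕ I
  ... | inj₁ none = ⊥-elim (<⇒≱ (≤-trans 1≤ℓ enough) (≤-reflexive (count-none (Adj? v₁) none)))
  ... | inj₂ (w , J , σ , v₁~w , w-min)
    -- Only `w` has to be leftmost: vertices ahead of all new ends are then non-neighbours of `v₁`.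
    -- The other `ℓ ∸ 1` neighbours are arbitrary.
    with ws , R , τ , len , v₁~ws ← choose (Adj? v₁) (ℓ ∸ 1) J
      (∸-monoˡ-≤ 1 (subst (ℓ ≤_) (≡-trans (count-↭ (Adj? v₁) σ) (count-yes (Adj? v₁) J v₁~w)) enough)) =
    w ∷ ws , R , |E|≡ℓ , v₁~w ∷ v₁~ws , I↭ ,
    greedy _ refl (discard initial [] (≤-reflexive |E|≡ℓ) I↭ λ { i∈R (i<w ∷ _) →
      (λ i~v₁ → <⇒≱ i<w (All.lookup w-min (∈-resp-↭ (↭-sym τ) (∈-++⁺ʳ ws i∈R)) (Adj-sym i~v₁))) ,
      ≤-trans (<⇒≤ i<w) (Adj⇒≤ v₁~w) })
    where
    |E|≡ℓ : suc (length ws) ≡ ℓ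
    |E|≡ℓ = ≡-trans (cong suc len) (m+[n∸m]≡n 1≤ℓ)

    I↭ : I ↭ w ∷ ws ++ R
    I↭ = trans σ (prep w τ)

  -- Assembling the subdivision.

  subdivision : SpanningK2Subdiv G ℓ
  subdivision with E , R , |E|≡ℓ , v₁~E , I↭ , qs , heads , covers , linked ← first-step =
    -- The paths are indexed by positions in `qs`, whose length is `ℓ` only propositionally.
    subst (SpanningK2Subdiv G) |qs|≡ℓ (P , P-path , P-disjoint , P-covers)
    where
    |qs|≡ℓ : length qs ≡ ℓ
    |qs|≡ℓ = ≡-trans (≡-sym (length-map proj₁ qs)) (≡-trans (↭-length heads) |E|≡ℓ)

    -- The source of uniqueness, disjointness and covering alike.
    all↭ : allFin n ↭ z ∷ v₁ ∷ concatMap path qs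
    all↭ = trans allFin↭ (prep z (prep v₁ (trans I↭ (↭-sym covers))))

    all-unique : Unique (z ∷ v₁ ∷ concatMap path qs)
    all-unique = Unique-resp-↭ all↭ (Unique.allFin⁺ n)

    qs-unique : Unique (concatMap path qs)
    qs-unique = Unique.drop⁺ 2 all-unique

    P : Fin (length qs) → List V
    P p = v₁ ∷ path (lookup qs p) ++ [ z ]

    v₁~head : ∀ p → Adj G v₁ (proj₁ (lookup qs p))
    v₁~head p = All.lookup (All.map⁻ (All-resp-↭ (↭-sym heads) v₁~E)) (∈-lookup p)

    P-unique : ∀ p → Unique (P p)
    P-unique p with (_ ∷ z∉) ∷ v₁∉ ∷ _ ← all-unique =
      All.++⁺ (All.tabulate (All.lookup v₁∉ ∘ ∈-lookup-concatMap path qs p)) (v₁≢z ∷ []) ∷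
      Unique.++⁺ (concatMap-unique⁻ path qs qs-unique p) ([] ∷ [])
        λ { (v∈ , here refl) → All.lookup z∉ (∈-lookup-concatMap path qs p v∈) refl }

    P-path : ∀ p → IsV1VnPath G (P p)
    P-path p = P-unique p , v₁~head p ∷ All.lookup linked (∈-lookup p) ,
      v₁ , z , path (lookup qs p) , refl , v₁≡0 , cong (_∸ 1) z≡n-1 , λ ()

    P-disjoint : ∀ p q → p ≢ q → ∀ v → v ∈ P p → v ∈ P q → toℕ v ≡ 0 ⊎ toℕ v ≡ n ∸ 1
    P-disjoint p q p≢q v (here refl) _ = inj₁ v₁≡0
    P-disjoint p q p≢q v _ (here refl) = inj₁ v₁≡0
    P-disjoint p q p≢q v (there v∈p) (there v∈q)
      with ∈-++⁻ (path (lookup qs p)) v∈p | ∈-++⁻ (path (lookup qs q)) v∈q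
    ... | inj₂ (here refl) | _ = inj₂ (cong (_∸ 1) z≡n-1)
    ... | _ | inj₂ (here refl) = inj₂ (cong (_∸ 1) z≡n-1)
    ... | inj₁ v∈p′ | inj₁ v∈q′ = ⊥-elim (concatMap-disjoint path qs qs-unique p q p≢q v∈p′ v∈q′)

    -- `v₁` and `z` lie on every path; any one is a witness, and `1 ≤ ℓ` provides it.
    p₀ : Fin (length qs)
    p₀ = fromℕ< {0} (subst (1 ≤_) (≡-sym |qs|≡ℓ) 1≤ℓ)

    P-covers : ∀ v → ∃ λ p → v ∈ P p
    P-covers v with ∈-resp-↭ all↭ (∈-allFin v)
    ... | here refl = p₀ , there (∈-++⁺ʳ (path (lookup qs p₀)) (here refl))
    ... | there (here refl) = p₀ , here refl
    ... | there (there v∈) with v∈qs ← ∈-concatMap⁻ path {qs} v∈ =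
      Any.index v∈qs , there (∈-++⁺ˡ (lookup-index v∈qs))

theorem4 : (n k ℓ : ℕ) → ℓ ≤ k → 1 ≤ ℓ → ℓ + 2 ≤ n →
    (G : Graph n) → Bandwidth≤ G k →
    (∀ a → (ℓ + toℕ a) ⊓ ((k + ℓ) ⊓ (k + (n ∸ suc (toℕ a)))) ≤ deg G a) →
    SpanningK2Subdiv G ℓ
theorem4 0 k ℓ _ _ ℓ+2≤0 = ⊥-elim (<⇒≱ (≤-trans (s≤s z≤n) (m≤n+m 2 ℓ)) ℓ+2≤0)
theorem4 (suc m) k ℓ _ 1≤ℓ ℓ+2≤n G bandwidth degrees =
  Roots.subdivision G k ℓ 1≤ℓ ℓ+2≤n bandwidth degrees zero (fromℕ m) refl (cong suc (toℕ-fromℕ m))
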